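{- Let $m\ge1$ and $n\ge 2(m+1)$ be integers and $H$ a finite simple graph. Then $$\gamma_{gr}(C_n^m\circ H)=\begin{cases}\left\lfloor\frac{n}{m+1}\right\rfloor(\gamma_{gr}(H)-(m+1))+n & \text{if } \gamma_{gr}(H)\ge m+1,\\[2pt] 2\gamma_{gr}(H)+n-(2m+2) & \text{if } \gamma_{gr}(H)\le m.\end{cases}$$
   Context: $C_n^m$ is the $m$-th power of the cycle $C_n$ on $[n]$ (two vertices adjacent iff their distance in $C_n$ is at most $m$). The lexicographic product $G\circ H$ has vertex set $V(G)\times V(H)$, with $(g_1,h_1)\sim(g_2,h_2)$ iff $g_1g_2\in E(G)$, or $g_1=g_2$ and $h_1h_2\in E(H)$. For a sequence $S=(v_1,\dots,v_k)$ of distinct vertices, $PN_S(v_i)=N[v_i]\setminus\bigcup_{j<i}N[v_j]$; $S$ is legal dominating if $\{v_1,\dots,v_k\}$ dominates the graph and each $PN_S(v_i)\neq\emptyset$; $\gamma_{gr}$ is the maximum length of such a sequence. -}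

module Defs where

open import Data.Nat using (ℕ; zero; suc; _+_; _*_; _∸_; _≤_; _<_; _⊓_; ∣_-_∣)
open import Data.Nat.DivMod using (_/_)
open import Data.Fin using (Fin; toℕ)
open import Data.List using (List; length; lookup)
open import Data.List.Membership.Propositional using (_∈_)
open import Data.List.Relation.Unary.Unique.Propositional using (Unique)
open import Data.Product using (Σ; ∃; _×_; _,_)
open import Data.Sum using (_⊎_)
open import Relation.Nullary using (¬_)
open import Relation.Binary.PropositionalEquality using (_≡_)

record Graph (V : Set) : Set₁ where
  field
    Adj : V → V → Set
open Graph public

record IsSimple {V : Set} (G : Graph V) : Set where
  field
    sym    : ∀ {u v} → Adj G u v → Adj G v u
    irrefl : ∀ {v} → ¬ Adj G v v

ClosedNbh : {V : Set} (G : Graph V) → V → V → Set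
ClosedNbh G v u = (u ≡ v) ⊎ Adj G v u

Dominates : {V : Set} (G : Graph V) → List V → Set
Dominates G S = ∀ u → ∃ λ v → v ∈ S × ClosedNbh G v u

Footprinted : {V : Set} (G : Graph V) → List V → Set
Footprinted G S = (i : Fin (length S)) →
  ∃ λ u → ClosedNbh G (lookup S i) u ×
          ((j : Fin (length S)) → toℕ j < toℕ i → ¬ ClosedNbh G (lookup S j) u)

LegalDominating : {V : Set} (G : Graph V) → List V → Set
LegalDominating G S = Unique S × Dominates G S × Footprinted G S

IsGrundyDom : {V : Set} (G : Graph V) → ℕ → Set
IsGrundyDom G d =
  (∃ λ S → LegalDominating G S × length S ≡ d) ×
  (∀ S → LegalDominating G S → length S ≤ d)

cycDist : (n : ℕ) → Fin n → Fin n → ℕ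
cycDist n i j = ∣ toℕ i - toℕ j ∣ ⊓ (n ∸ ∣ toℕ i - toℕ j ∣)

CyclePow : (n m : ℕ) → Graph (Fin n)
Adj (CyclePow n m) i j = (0 < cycDist n i j) × (cycDist n i j ≤ m)

Lex : {V W : Set} → Graph V → Graph W → Graph (V × W)
Adj (Lex G H) (g₁ , h₁) (g₂ , h₂) = Adj G g₁ g₂ ⊎ ((g₁ ≡ g₂) × Adj H h₁ h₂)

{-# OPTIONS --safe #-}
module Submission where

-- Call a play (c , h) of a legal sequence vertical if it has a footprint in its own fibre {c} × H; choose such
-- a footprint whenever there is one, and let a be the cycle coordinate of the chosen footprint.  The plays
-- with a given a project to a legal sequence of H, so there are at most γ_gr(H) of them.  The plays whose a
-- is not the centre of an earlier play ("keys") project to a legal sequence of the power of the cycle, and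
-- every other play shares its a with a vertical key.  Hence the length is at most p γ_gr(H) + q for
-- p vertical and q other keys.  Assign to a key all arcs of m + 1 consecutive vertices through c and a: for
-- distinct keys these are disjoint nonempty sets, with m + 1 arcs for a vertical key, so p (m + 1) + q ≤ n.
-- The 2m + 1 vertices of N[c] for the first key also give p + q + 2m ≤ n, which settles p ≤ 1.
--
-- Conversely, for p ≥ 2 with r = n − p (m + 1) ≥ 0, a full copy of a Grundy sequence of H over 0, then single
-- plays over 1, …, r, then full copies over r + (m + 1), …, r + (p − 1)(m + 1) form a legal dominating sequence.

open import Defs
open import Data.Nat using (ℕ; zero; suc; _+_; _*_; _∸_; _≤_; _<_; _⊓_; ∣_-_∣; z≤n; s≤s)
open import Data.Nat.DivMod using (_/_; m/n*n≤m; m*n/n≡m; /-monoˡ-≤)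
open import Data.Nat.Properties
open import Data.Fin as Fin using (Fin; toℕ; fromℕ<)
import Data.Fin.Properties as Fin
open import Data.Product.Properties using (≡-dec)
open import Induction.WellFounded using (Acc; acc)
open import Data.Fin.Induction using (<-wellFounded)
open import Data.Product using (∃; _×_; _,_; proj₁; proj₂)
open import Data.Sum using (_⊎_; inj₁; inj₂)
open import Data.List using (List; []; _∷_; _++_; length; lookup; map; filter; tabulate; allFin)
open import Data.List.Properties using (length-++; length-map; length-tabulate; map-tabulate; tabulate-lookup)
open import Data.List.Membership.Propositional using (_∈_; find)
open import Data.List.Membership.Propositional.Properties
  using (∈-lookup; ∈-map⁺; ∈-map⁻; ∈-filter⁺; ∈-allFin; ∈-++⁺ˡ; ∈-++⁺ʳ)
open import Data.List.Relation.Unary.All as All using (All; []; _∷_)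
import Data.List.Relation.Unary.All.Properties as All
open import Data.List.Relation.Unary.AllPairs as AllPairs using (AllPairs; []; _∷_)
import Data.List.Relation.Unary.AllPairs.Properties as AllPairs
open import Data.List.Relation.Unary.Any as Any using (Any; here; there)
open import Data.List.Relation.Unary.Unique.Propositional using (Unique)
import Data.List.Relation.Unary.Unique.Propositional.Properties as Unique
open import Relation.Binary.PropositionalEquality
open import Relation.Nullary using (¬_; Dec; yes; no; contradiction)
open import Relation.Nullary.Decidable using (_×-dec_; _⊎-dec_; _→-dec_; ¬?; decidable-stable; ¬¬-excluded-middle)
open import Function using (_∘_; id)

-- Counting in lists and weights of keys

lookup-injective : {A : Set} {xs : List A} → Unique xs → ∀ i j → lookup xs i ≡ lookup xs j → i ≡ j
lookup-injective (x∉ ∷ u) Fin.zero Fin.zero _ = refl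
lookup-injective {xs = _ ∷ xs} (x∉ ∷ u) Fin.zero (Fin.suc j) eq = contradiction eq (All.lookup x∉ (∈-lookup {xs = xs} j))
lookup-injective {xs = _ ∷ xs} (x∉ ∷ u) (Fin.suc i) Fin.zero eq = contradiction (sym eq) (All.lookup x∉ (∈-lookup {xs = xs} i))
lookup-injective (x∉ ∷ u) (Fin.suc i) (Fin.suc j) eq = cong Fin.suc (lookup-injective u i j eq)

length-unique≤ : ∀ {n} {xs : List (Fin n)} → Unique xs → length xs ≤ n
length-unique≤ u = Fin.injective⇒≤ (λ {i} {j} → lookup-injective u i j)

length-complement : {A : Set} {P : A → Set} (P? : ∀ x → Dec (P x)) →
  ∀ xs → length xs ≡ length (filter P? xs) + length (filter (¬? ∘ P?) xs)
length-complement P? [] = refl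
length-complement P? (x ∷ xs) with P? x
... | yes _ = cong suc (length-complement P? xs)
... | no _ = trans (cong suc (length-complement P? xs)) (sym (+-suc _ _))

allPairs-map-with : {A : Set} {P : A → Set} {R S : A → A → Set} →
  (∀ {x y} → P x → P y → R x y → S x y) →
  ∀ {xs} → All P xs → AllPairs R xs → AllPairs S xs
allPairs-map-with f [] [] = []
allPairs-map-with f (p ∷ ps) (r ∷ rs) = All.zipWith (λ (q , s) → f p q s) (ps , r) ∷ allPairs-map-with f ps rs

module Weight {n : ℕ} {I : Set} (c a : I → Fin n) where

  diag? : ∀ i → Dec (a i ≡ c i)
  diag? i = a i Fin.≟ c i

  -- With `w = g` this bounds the length of a legal sequence by its keys; with `w = suc m` it counts
  -- the arcs assigned to the keys.
  weight : ℕ → List I → ℕ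
  weight w is = length (filter diag? is) * w + length (filter (¬? ∘ diag?) is)

-- Legal sequences as lists of plays with chosen footprints

module _ {V : Set} (G : Graph V) where

  -- Each play is paired with one footprint. In this form legality passes through `map`, `filter`
  -- and `++`.
  LegalPairs : List (V × V) → Set
  LegalPairs ps = All (λ p → ClosedNbh G (proj₁ p) (proj₂ p)) ps
                × AllPairs (λ p q → ¬ ClosedNbh G (proj₁ p) (proj₂ q)) ps

  -- A repeated footprint would already be dominated by the earlier of its two plays.
  legal⇒unique-targets : ∀ {ps} → LegalPairs ps → Unique (map proj₂ ps)
  legal⇒unique-targets (cov , fr) = AllPairs.map⁺
    (allPairs-map-with (λ {p} cp _ f e → f (subst (ClosedNbh G (proj₁ p)) e cp)) cov fr)

  legal⇒unique : ∀ {ps} → LegalPairs ps → Unique (map proj₁ ps)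
  legal⇒unique (cov , fr) = AllPairs.map⁺
    (allPairs-map-with (λ {_} {q} _ cq f e → f (subst (λ v → ClosedNbh G v (proj₂ q)) (sym e) cq)) cov fr)

  private
    footprint : (Q : V → Set) → ∀ {ps} → LegalPairs ps → All (Q ∘ proj₂) ps →
      (i : Fin (length (map proj₁ ps))) →
      ∃ λ u → Q u × ClosedNbh G (lookup (map proj₁ ps) i) u ×
              ((j : Fin (length (map proj₁ ps))) → toℕ j < toℕ i → ¬ ClosedNbh G (lookup (map proj₁ ps) j) u)
    footprint Q {(v , u) ∷ _} (c ∷ _ , _) (q ∷ _) Fin.zero = u , q , c , λ _ ()
    footprint Q {(v , _) ∷ _} (_ ∷ cs , f ∷ fs) (_ ∷ qs) (Fin.suc i)
      -- The condition of avoiding the head `v` is put into the predicate, so that the recursive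
      -- call carries it along.
      with footprint (λ u → Q u × ¬ ClosedNbh G v u) (cs , fs) (All.zip (qs , f)) i
    ... | u , (q , ¬n) , n , ¬ns = u , q , n , λ { Fin.zero _ → ¬n ; (Fin.suc j) (s≤s lt) → ¬ns j lt }

  legal⇒legalDominating : ∀ {ps} → LegalPairs ps → Dominates G (map proj₁ ps) → LegalDominating G (map proj₁ ps)
  legal⇒legalDominating {ps} l dom = legal⇒unique l , dom , λ i →
    let u , _ , n , ¬ns = footprint (λ _ → V) l (All.universal proj₂ ps) i in u , n , ¬ns

  footprinted⇒legal : ∀ {S} → Footprinted G S → ∃ λ ps → LegalPairs ps × map proj₁ ps ≡ S
  footprinted⇒legal {S} fp = tabulate pair
    , (All.tabulate⁺ (λ i → proj₁ (proj₂ (fp i))) , AllPairs.tabulate⁺-< (λ {i} {j} lt → proj₂ (proj₂ (fp j)) i lt))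
    , trans (map-tabulate pair proj₁) (tabulate-lookup S)
    where
      pair : Fin (length S) → V × V
      pair i = lookup S i , proj₁ (fp i)

-- Extending legal sequences to dominating ones

module _ {k : ℕ} (H : Graph (Fin k)) (adj? : ∀ u v → Dec (Adj H u v)) where

  closedNbh? : ∀ v u → Dec (ClosedNbh H v u)
  closedNbh? v u = (u Fin.≟ v) ⊎-dec adj? v u

  private
    -- An undominated vertex can be appended as its own footprint. Footprints are distinct, so a
    -- legal sequence has at most `k` plays and the fuel cannot run out.
    extend : ∀ {g} → (∀ S → LegalDominating H S → length S ≤ g) →
             ∀ fuel ps → suc k ≤ length ps + fuel → LegalPairs H ps → length ps ≤ g
    extend bound zero ps enough l = contradiction (length-unique≤ (legal⇒unique-targets H l))
      (<⇒≱ (subst (k <_) (trans (+-identityʳ _) (sym (length-map proj₂ ps))) enough))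
    extend bound (suc fuel) ps enough l@(cov , fr) with Fin.all? (λ u → Any.any? (λ v → closedNbh? v u) (map proj₁ ps))
    ... | yes dom = subst (_≤ _) (length-map proj₁ ps)
                      (bound _ (legal⇒legalDominating H l λ u → find (dom u)))
    ... | no ¬dom with Fin.¬∀⟶∃¬ k _ (λ u → Any.any? (λ v → closedNbh? v u) (map proj₁ ps)) ¬dom
    ...   | u , ¬any = ≤-trans (m≤m+n _ 1) (subst (_≤ _) len (extend bound fuel (ps ++ (u , u) ∷ [])
                         (subst (suc k ≤_) (trans (+-suc _ fuel)
                           (trans (cong (_+ fuel) (+-comm 1 (length ps))) (cong (_+ fuel) (sym len)))) enough)
                         ( All.++⁺ cov (inj₁ refl ∷ [])
                         , AllPairs.++⁺ fr ([] ∷ []) (All.map (_∷ []) (All.map⁻ (All.¬Any⇒All¬ _ ¬any))))))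
      where
        len : length (ps ++ (u , u) ∷ []) ≡ length ps + 1
        len = length-++ ps

  -- Needed because the plays projected from one fibre are legal in `H` but may fail to dominate it.
  legal-length≤ : ∀ {g} → (∀ S → LegalDominating H S → length S ≤ g) →
                  ∀ ps → LegalPairs H ps → length ps ≤ g
  legal-length≤ bound ps = extend bound (suc k) ps (m≤n+m (suc k) (length ps))

-- Distance in the power of the cycle

module Cycle (m n : ℕ) (2m<n : m + m < n) where

  m<n : m < n
  m<n = ≤-<-trans (m≤m+n m m) 2m<n

  -- Cyclic distance at most `m` without subtraction: directly, or through the edge between `n - 1`
  -- and `0` in one of the two directions.
  Near : ℕ → ℕ → Set
  Near x y = (x ≤ y + m × y ≤ x + m) ⊎ (x + n ≤ y + m) ⊎ (y + n ≤ x + m)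

  near-sym : ∀ {x y} → Near x y → Near y x
  near-sym (inj₁ (p , q)) = inj₁ (q , p)
  near-sym (inj₂ (inj₁ p)) = inj₂ (inj₂ p)
  near-sym (inj₂ (inj₂ p)) = inj₂ (inj₁ p)

  gap : ℕ → ℕ → ℕ
  gap x y = ∣ x - y ∣ ⊓ (n ∸ ∣ x - y ∣)

  gap-comm : ∀ x y → gap x y ≡ gap y x
  gap-comm x y rewrite ∣-∣-comm x y = refl

  private
    gap≤⇒near-≤ : ∀ {x y} → x ≤ y → y < n → gap x y ≤ m → Near x y
    gap≤⇒near-≤ {x} {y} x≤y y<n g with ≤-total ∣ x - y ∣ (n ∸ ∣ x - y ∣)
    ... | inj₁ le = inj₁ (m≤n⇒m≤n+o m x≤y , (begin
          y             ≤⟨ m≤n+∣m-n∣ y x ⟩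
          x + ∣ y - x ∣ ≡⟨ cong (x +_) (∣-∣-comm y x) ⟩
          x + ∣ x - y ∣ ≤⟨ +-monoʳ-≤ x (subst (_≤ m) (m≤n⇒m⊓n≡m le) g) ⟩
          x + m         ∎))
      where open ≤-Reasoning
    ... | inj₂ le = inj₂ (inj₁ (begin
          x + n                   ≤⟨ +-monoʳ-≤ x (m≤n+m∸n n (y ∸ x)) ⟩
          x + (y ∸ x + (n ∸ (y ∸ x))) ≡⟨ sym (+-assoc x (y ∸ x) _) ⟩
          x + (y ∸ x) + (n ∸ (y ∸ x)) ≡⟨ cong (_+ (n ∸ (y ∸ x))) (m+[n∸m]≡n x≤y) ⟩
          y + (n ∸ (y ∸ x))       ≡⟨ cong (λ d → y + (n ∸ d)) (sym (m≤n⇒∣m-n∣≡n∸m x≤y)) ⟩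
          y + (n ∸ ∣ x - y ∣)     ≤⟨ +-monoʳ-≤ y (subst (_≤ m) (m≥n⇒m⊓n≡n le) g) ⟩
          y + m                   ∎))
      where open ≤-Reasoning

    near⇒gap≤-≤ : ∀ {x y} → x ≤ y → x < n → Near x y → gap x y ≤ m
    near⇒gap≤-≤ {x} {y} x≤y x<n (inj₁ (_ , q)) = m≤n⇒m⊓o≤n _ (begin
          ∣ x - y ∣ ≡⟨ m≤n⇒∣m-n∣≡n∸m x≤y ⟩
          y ∸ x     ≤⟨ m≤n+o⇒m∸n≤o y x q ⟩
          m         ∎)
      where open ≤-Reasoning
    near⇒gap≤-≤ {x} {y} x≤y x<n (inj₂ (inj₁ p)) = m≤n⇒o⊓m≤n ∣ x - y ∣ (m≤n+o⇒m∸n≤o n ∣ x - y ∣ (begin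
          n               ≤⟨ m+n≤o⇒n≤o∸m x p ⟩
          y + m ∸ x       ≡⟨ +-∸-comm m x≤y ⟩
          y ∸ x + m       ≡⟨ cong (_+ m) (sym (m≤n⇒∣m-n∣≡n∸m x≤y)) ⟩
          ∣ x - y ∣ + m   ∎))
      where
        open ≤-Reasoning
        m+n≤o⇒n≤o∸m : ∀ a {b c} → a + b ≤ c → b ≤ c ∸ a
        m+n≤o⇒n≤o∸m a {b} {c} le = m+n≤o⇒m≤o∸n b (subst (λ t → t ≤ c) (+-comm a b) le)
    near⇒gap≤-≤ {x} {y} x≤y x<n (inj₂ (inj₂ p)) = contradiction (begin-strict
          y + n ≤⟨ p ⟩
          x + m ≤⟨ +-monoˡ-≤ m x≤y ⟩
          y + m <⟨ +-monoʳ-< y m<n ⟩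
          y + n ∎) (<-irrefl refl)
      where open ≤-Reasoning

  gap≤⇒near : ∀ {x y} → x < n → y < n → gap x y ≤ m → Near x y
  gap≤⇒near {x} {y} x<n y<n g with ≤-total x y
  ... | inj₁ x≤y = gap≤⇒near-≤ x≤y y<n g
  ... | inj₂ y≤x = near-sym (gap≤⇒near-≤ y≤x x<n (subst (_≤ m) (gap-comm x y) g))

  near⇒gap≤ : ∀ {x y} → x < n → y < n → Near x y → gap x y ≤ m
  near⇒gap≤ {x} {y} x<n y<n p with ≤-total x y
  ... | inj₁ x≤y = near⇒gap≤-≤ x≤y x<n p
  ... | inj₂ y≤x = subst (_≤ m) (gap-comm y x) (near⇒gap≤-≤ y≤x y<n (near-sym p))

  G : Graph (Fin n)
  G = CyclePow n m

  adj-irrefl : ∀ {c} → ¬ Adj G c c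
  adj-irrefl {c} (p , _) = <-irrefl (sym (cong (λ d → d ⊓ (n ∸ ∣ toℕ c - toℕ c ∣)) (∣n-n∣≡0 (toℕ c)))) p

  adj? : ∀ c a → Dec (Adj G c a)
  adj? c a = (0 <? cycDist n c a) ×-dec (cycDist n c a ≤? m)

  near⇒adj : ∀ {c a} → c ≢ a → Near (toℕ c) (toℕ a) → Adj G c a
  near⇒adj {c} {a} c≢a p = ⊓-pres-m< (n≢0⇒n>0 d≢0) (m<n⇒0<n∸m d<n)
                         , near⇒gap≤ (Fin.toℕ<n c) (Fin.toℕ<n a) p
    where
      d≢0 : ∣ toℕ c - toℕ a ∣ ≢ 0
      d≢0 = c≢a ∘ Fin.toℕ-injective ∘ ∣m-n∣≡0⇒m≡n
      d<n : ∣ toℕ c - toℕ a ∣ < n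
      d<n = ≤-<-trans (∣m-n∣≤m⊔n (toℕ c) (toℕ a)) (⊔-pres-<m (Fin.toℕ<n c) (Fin.toℕ<n a))

  near⇒nbh : ∀ {c a} → Near (toℕ c) (toℕ a) → ClosedNbh G c a
  near⇒nbh {c} {a} p with a Fin.≟ c
  ... | yes a≡c = inj₁ a≡c
  ... | no a≢c = inj₂ (near⇒adj (a≢c ∘ sym) p)

  adj⇒near : ∀ {c a} → Adj G c a → Near (toℕ c) (toℕ a)
  adj⇒near {c} {a} (_ , p) = gap≤⇒near (Fin.toℕ<n c) (Fin.toℕ<n a) p

  nbh⇒near : ∀ {c a} → ClosedNbh G c a → Near (toℕ c) (toℕ a)
  nbh⇒near {c} (inj₁ refl) = inj₁ (m≤m+n (toℕ c) m , m≤m+n (toℕ c) m)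
  nbh⇒near (inj₂ p) = adj⇒near p

  -- Arcs and closed neighbourhoods on the cycle

  -- Arc x b: x lies on the arc of m + 1 vertices that ends at b.
  Arc : ℕ → ℕ → Set
  Arc x b = (x ≤ b × b ≤ x + m) ⊎ (b + n ≤ x + m)

  arcs-meet⇒near : ∀ {x y b} → x < n → y < n → Arc x b → Arc y b → Near x y
  arcs-meet⇒near _ _ (inj₁ (p , q)) (inj₁ (r , s)) = inj₁ (≤-trans p s , ≤-trans r q)
  arcs-meet⇒near _ _ (inj₁ (p , q)) (inj₂ r) = inj₂ (inj₁ (≤-trans (+-monoˡ-≤ n p) r))
  arcs-meet⇒near _ _ (inj₂ q) (inj₁ (r , s)) = inj₂ (inj₂ (≤-trans (+-monoˡ-≤ n r) q))
  arcs-meet⇒near x<n y<n (inj₂ q) (inj₂ s) = inj₁ (wrap x<n s , wrap y<n q)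
    where
      wrap : ∀ {x y b} → x < n → b + n ≤ y + m → x ≤ y + m
      wrap {b = b} x<n q = ≤-trans (<⇒≤ x<n) (≤-trans (m≤n+m n b) q)

  arc-refl : ∀ {x} → Arc x x
  arc-refl {x} = inj₁ (≤-refl , m≤m+n x m)

  -- Addition modulo `n`, recording whether the sum wraps; for `j ≤ n` it wraps at most once.
  rotate : (x : Fin n) (j : ℕ) → j ≤ n →
           ∃ λ (r : Fin n) → (toℕ r ≡ toℕ x + j) ⊎ (toℕ r + n ≡ toℕ x + j)
  rotate x j j≤n with toℕ x + j <? n
  ... | yes lt = fromℕ< lt , inj₁ (Fin.toℕ-fromℕ< lt)
  ... | no ≮n = fromℕ< lt , inj₂ (trans (cong (_+ n) (Fin.toℕ-fromℕ< lt)) (m∸n+n≡m (≮⇒≥ ≮n)))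
    where
      lt : toℕ x + j ∸ n < n
      lt = +-cancelʳ-< n _ _ (subst (_< n + n) (sym (m∸n+n≡m (≮⇒≥ ≮n))) (+-mono-<-≤ (Fin.toℕ<n x) j≤n))

  no-wrap : ∀ (x : Fin n) {r i j} → r ≡ toℕ x + i → j < n → r + n ≢ toℕ x + j
  no-wrap x {i = i} {j} refl j<n f = <⇒≢ (≤-trans j<n (m≤n+m n i))
    (sym (+-cancelˡ-≡ (toℕ x) (i + n) j (trans (sym (+-assoc (toℕ x) i n)) f)))

  rotate-injective : ∀ x {i j} (p : i ≤ n) (q : j ≤ n) → i < n → j < n →
                     proj₁ (rotate x i p) ≡ proj₁ (rotate x j q) → i ≡ j
  rotate-injective x {i} {j} p q i<n j<n eq with rotate x i p | rotate x j q
  rotate-injective x {i} {j} p q i<n j<n refl | r , inj₁ e | _ , inj₁ f = +-cancelˡ-≡ (toℕ x) i j (trans (sym e) f)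
  rotate-injective x {i} {j} p q i<n j<n refl | r , inj₂ e | _ , inj₂ f = +-cancelˡ-≡ (toℕ x) i j (trans (sym e) f)
  rotate-injective x {i} {j} p q i<n j<n refl | r , inj₁ e | _ , inj₂ f = contradiction f (no-wrap x e j<n)
  rotate-injective x {i} {j} p q i<n j<n refl | r , inj₂ e | _ , inj₁ f = contradiction e (no-wrap x f i<n)

  -- The ends of the `suc m` arcs through `x`, namely `x`, `x + 1`, ..., `x + m` modulo `n`.
  rot : Fin n → Fin (suc m) → Fin n
  rot x j = proj₁ (rotate x (toℕ j) (<⇒≤ (<-≤-trans (Fin.toℕ<n j) m<n)))

  rot-injective : ∀ x {i j} → rot x i ≡ rot x j → i ≡ j
  rot-injective x {i} {j} eq = Fin.toℕ-injective
    (rotate-injective x _ _ (<-≤-trans (Fin.toℕ<n i) m<n) (<-≤-trans (Fin.toℕ<n j) m<n) eq)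

  rot-arc : ∀ x j → Arc (toℕ x) (toℕ (rot x j))
  rot-arc x j with rotate x (toℕ j) (<⇒≤ (<-≤-trans (Fin.toℕ<n j) m<n))
  ... | r , inj₁ e = inj₁ (subst (toℕ x ≤_) (sym e) (m≤m+n (toℕ x) (toℕ j))
                          , subst (_≤ toℕ x + m) (sym e) (+-monoʳ-≤ (toℕ x) (≤-pred (Fin.toℕ<n j))))
  ... | r , inj₂ e = inj₂ (subst (_≤ toℕ x + m) (sym e) (+-monoʳ-≤ (toℕ x) (≤-pred (Fin.toℕ<n j))))

  -- If `y` comes at most `m` before `x`, the arc ending at `x` holds it. Otherwise `y` comes at
  -- most `m` after `x`, and the arc starting at `x`, which ends at `r`, holds it.
  arc-to-end : ∀ {x y r} → x < n → r < n → Near x y → (r ≡ x + m) ⊎ (r + n ≡ x + m) → Arc y x ⊎ Arc y r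
  arc-to-end {x} {y} x<n r<n (inj₁ (p , q)) e with ≤-total y x
  ... | inj₁ y≤x = inj₁ (inj₁ (y≤x , p))
  arc-to-end x<n r<n (inj₁ (p , q)) (inj₁ refl) | inj₂ x≤y = inj₂ (inj₁ (q , +-monoˡ-≤ m x≤y))
  arc-to-end {y = y} x<n r<n (inj₁ (p , q)) (inj₂ e) | inj₂ x≤y = inj₂ (inj₂ (subst (_≤ y + m) (sym e) (+-monoˡ-≤ m x≤y)))
  arc-to-end x<n r<n (inj₂ (inj₁ p)) e = inj₁ (inj₂ p)
  arc-to-end {y = y} x<n r<n (inj₂ (inj₂ p)) (inj₁ refl) = contradiction (<-≤-trans r<n (m≤n+m n y)) (≤⇒≯ p)
  arc-to-end {x} {y} {r} x<n r<n (inj₂ (inj₂ p)) (inj₂ e) = inj₂ (inj₁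
    ( +-cancelʳ-≤ n y r (subst (y + n ≤_) (sym e) p)
    , ≤-trans (+-cancelʳ-≤ n r m (subst₂ _≤_ (sym e) (+-comm n m) (+-monoˡ-≤ m (<⇒≤ x<n)))) (m≤n+m m y)))

  common-window : ∀ {x y} → ClosedNbh G x y → ∃ λ b → Arc (toℕ x) (toℕ b) × Arc (toℕ y) (toℕ b)
  common-window {x} {y} p with rotate x m (<⇒≤ m<n)
  ... | r , e with arc-to-end (Fin.toℕ<n x) (Fin.toℕ<n r) (nbh⇒near p) e
  ...   | inj₁ q = x , arc-refl , q
  ...   | inj₂ q = r , ends e , q
    where
      ends : (toℕ r ≡ toℕ x + m) ⊎ (toℕ r + n ≡ toℕ x + m) → Arc (toℕ x) (toℕ r)
      ends (inj₁ e) = inj₁ (subst (toℕ x ≤_) (sym e) (m≤m+n _ m) , ≤-reflexive e)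
      ends (inj₂ e) = inj₂ (≤-reflexive e)

  nbhd-list : ∀ c → ∃ λ us → Unique us × All (ClosedNbh G c) us × length us ≡ suc (m + m)
  nbhd-list c = tabulate u , Unique.tabulate⁺ u-injective , All.tabulate⁺ u-near , length-tabulate u
    where
      -- Adding `n ∸ m` steps back by `m`, so the list runs from `c - m` to `c + m`; the entries are
      -- distinct because `m + m < n`.
      start = rotate c (n ∸ m) (m∸n≤m n m)
      c′ = proj₁ start
      bound : (j : Fin (suc (m + m))) → toℕ j < n
      bound j = <-≤-trans (Fin.toℕ<n j) 2m<n
      u : Fin (suc (m + m)) → Fin n
      u j = proj₁ (rotate c′ (toℕ j) (<⇒≤ (bound j)))
      u-injective : ∀ {i j} → u i ≡ u j → i ≡ j
      u-injective {i} {j} = Fin.toℕ-injective ∘ rotate-injective c′ _ _ (bound i) (bound j)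
      c′+m : (toℕ c′ + m ≡ toℕ c + n) ⊎ (toℕ c′ + m ≡ toℕ c)
      c′+m with proj₂ start
      ... | inj₁ e = inj₁ (trans (cong (_+ m) e) (trans (+-assoc (toℕ c) _ m) (cong (toℕ c +_) (m∸n+n≡m (<⇒≤ m<n)))))
      ... | inj₂ e = inj₂ (+-cancelʳ-≡ n _ _ (begin
          toℕ c′ + m + n     ≡⟨ +-assoc (toℕ c′) m n ⟩
          toℕ c′ + (m + n)   ≡⟨ cong (toℕ c′ +_) (+-comm m n) ⟩
          toℕ c′ + (n + m)   ≡⟨ sym (+-assoc (toℕ c′) n m) ⟩
          toℕ c′ + n + m     ≡⟨ cong (_+ m) e ⟩
          toℕ c + (n ∸ m) + m ≡⟨ +-assoc (toℕ c) _ m ⟩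
          toℕ c + (n ∸ m + m) ≡⟨ cong (toℕ c +_) (m∸n+n≡m (<⇒≤ m<n)) ⟩
          toℕ c + n          ∎))
        where open ≡-Reasoning
      swap : ∀ x y z → x + y + z ≡ x + z + y
      swap x y z = trans (+-assoc x y z) (trans (cong (x +_) (+-comm y z)) (sym (+-assoc x z y)))
      straight : ∀ {x c j} → j ≤ m + m → x + m ≡ c + j → Near c x
      straight {x} {c} {j} j≤ e = inj₁ (subst (c ≤_) (sym e) (m≤m+n c j) ,
        +-cancelʳ-≤ m x (c + m) (subst₂ _≤_ (sym e) (sym (+-assoc c m m)) (+-monoʳ-≤ c j≤)))
      -- One wrap in total over the two rotations gives the direct form of `Near`; none or two give
      -- the two wrapped forms.
      near : ∀ {x c′ c j} → j ≤ m + m → (x ≡ c′ + j) ⊎ (x + n ≡ c′ + j) →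
             (c′ + m ≡ c + n) ⊎ (c′ + m ≡ c) → Near c x
      near {x} {c′} {c} {j} j≤ (inj₁ e) (inj₁ f) = inj₂ (inj₁ (begin
          c + n       ≤⟨ m≤m+n (c + n) j ⟩
          c + n + j   ≡⟨ cong (_+ j) (sym f) ⟩
          c′ + m + j  ≡⟨ swap c′ m j ⟩
          c′ + j + m  ≡⟨ cong (_+ m) (sym e) ⟩
          x + m       ∎))
        where open ≤-Reasoning
      near {x} {c′} {c} {j} j≤ (inj₁ e) (inj₂ f) = straight j≤ (begin
          x + m       ≡⟨ cong (_+ m) e ⟩
          c′ + j + m  ≡⟨ swap c′ j m ⟩
          c′ + m + j  ≡⟨ cong (_+ j) f ⟩
          c + j       ∎)
        where open ≡-Reasoning
      near {x} {c′} {c} {j} j≤ (inj₂ e) (inj₁ f) = straight j≤ (+-cancelʳ-≡ n _ _ (begin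
          x + m + n   ≡⟨ swap x m n ⟩
          x + n + m   ≡⟨ cong (_+ m) e ⟩
          c′ + j + m  ≡⟨ swap c′ j m ⟩
          c′ + m + j  ≡⟨ cong (_+ j) f ⟩
          c + n + j   ≡⟨ swap c n j ⟩
          c + j + n   ∎))
        where open ≡-Reasoning
      near {x} {c′} {c} {j} j≤ (inj₂ e) (inj₂ f) = inj₂ (inj₂ (+-cancelʳ-≤ m _ _ (begin
          x + n + m   ≡⟨ cong (_+ m) e ⟩
          c′ + j + m  ≡⟨ swap c′ j m ⟩
          c′ + m + j  ≡⟨ cong (_+ j) f ⟩
          c + j       ≤⟨ +-monoʳ-≤ c j≤ ⟩
          c + (m + m) ≡⟨ sym (+-assoc c m m) ⟩
          c + m + m   ∎)))
        where open ≤-Reasoning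
      u-near : ∀ j → ClosedNbh G c (u j)
      u-near j = near⇒nbh (near (≤-pred (Fin.toℕ<n j)) (proj₂ (rotate c′ (toℕ j) (<⇒≤ (bound j)))) c′+m)

  -- Packing bounds for legal sequences in the cycle power

  module _ {I : Set} (c a : I → Fin n) where

    Covers : I → Set
    Covers i = ClosedNbh G (c i) (a i)

    Fresh : I → I → Set
    Fresh i j = ¬ ClosedNbh G (c i) (a j)

    Window : Fin n → I → Set
    Window b i = Arc (toℕ (c i)) (toℕ b) × Arc (toℕ (a i)) (toℕ b)

    open Weight c a

    -- An arc shared with a later `j` would hold both `c i` and `a j`, so `c i` would dominate the
    -- footprint of `j`.
    windows-disjoint : ∀ {i js b} → All (Fresh i) js → Window b i → ¬ Any (Window b) js
    windows-disjoint (f ∷ _) (p , _) (here (_ , q)) = f (near⇒nbh (arcs-meet⇒near (Fin.toℕ<n _) (Fin.toℕ<n _) p q))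
    windows-disjoint (_ ∷ fs) w (there any) = windows-disjoint fs w any

    -- A diagonal entry receives all `suc m` arcs through its centre, any other entry one arc
    -- through centre and target. Arcs are named by their ends in `Fin n`, so at most `n` are
    -- available.
    packing : ∀ {is} → All Covers is → AllPairs Fresh is →
              ∃ λ bs → Unique bs × All (λ b → Any (Window b) is) bs × weight (suc m) is ≡ length bs
    packing [] [] = [] , [] , [] , refl
    packing {i ∷ is} (cov ∷ covs) (fr ∷ frs) with packing covs frs
    ... | bs , ubs , wbs , len with diag? i
    ...   | yes a≡c = tabulate (rot (c i)) ++ bs
                    , Unique.++⁺ (Unique.tabulate⁺ (rot-injective (c i))) ubs
                        (λ (p , q) → windows-disjoint fr (All.lookup own p) (All.lookup wbs q))
                    , All.++⁺ (All.map here own) (All.map there wbs)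
                    , (begin
                        suc m + length (filter diag? is) * suc m + length (filter (¬? ∘ diag?) is)
                          ≡⟨ +-assoc (suc m) (length (filter diag? is) * suc m) _ ⟩
                        suc m + weight (suc m) is  ≡⟨ cong₂ _+_ (sym (length-tabulate (rot (c i)))) len ⟩
                        length (tabulate (rot (c i))) + length bs ≡⟨ sym (length-++ (tabulate (rot (c i)))) ⟩
                        length (tabulate (rot (c i)) ++ bs) ∎)
      where
        open ≡-Reasoning
        own : All (λ b → Window b i) (tabulate (rot (c i)))
        own = All.tabulate⁺ (λ j → rot-arc (c i) j , subst (λ x → Arc (toℕ x) (toℕ (rot (c i) j))) (sym a≡c) (rot-arc (c i) j))
    ...   | no a≢c with common-window cov
    ...     | b , w = b ∷ bs
                    , All.tabulate (λ q b≡ → windows-disjoint fr w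
                        (subst (λ b → Any (Window b) is) (sym b≡) (All.lookup wbs q))) ∷ ubs
                    , here w ∷ All.map there wbs
                    , trans (+-suc _ _) (cong suc len)

    packing-bound : ∀ {is} → All Covers is → AllPairs Fresh is → weight (suc m) is ≤ n
    packing-bound covs frs with packing covs frs
    ... | bs , ubs , _ , len = subst (_≤ n) (sym len) (length-unique≤ ubs)

    -- The later footprints are distinct and avoid the `2m + 1` vertices of the closed neighbourhood
    -- of the first centre.
    length-bound : ∀ {i is} → All Covers (i ∷ is) → AllPairs Fresh (i ∷ is) → length (i ∷ is) + (m + m) ≤ n
    length-bound {i} {is} (_ ∷ covs) (fr ∷ frs) with nbhd-list (c i)
    ... | us , uus , nus , len = subst (_≤ n) eq (length-unique≤
            (Unique.++⁺ uus
               (AllPairs.map⁺ (allPairs-map-with (λ {x} cv _ f e → f (subst (ClosedNbh G (c x)) e cv)) covs frs))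
               (λ (p , q) → fresh-notin fr (All.lookup nus p) q)))
      where
        fresh-notin : ∀ {js x} → All (Fresh i) js → ClosedNbh G (c i) x → ¬ x ∈ map a js
        fresh-notin fs nb x∈ with ∈-map⁻ a x∈
        ... | j , j∈ , refl = All.lookup fs j∈ nb
        eq : length (us ++ map a is) ≡ suc (length is + (m + m))
        eq = trans (length-++ us) (trans (cong₂ _+_ len (length-map a is)) (cong suc (+-comm (m + m) (length is))))

-- Splitting and fibrewise counting

module _ {A : Set} {P Q : A → Set} (P? : ∀ x → Dec (P x)) (Q? : ∀ x → Dec (Q x)) where

  -- Used with `P` diagonal and `Q` key: off-diagonal keys are counted singly, all other plays are
  -- grouped by target.
  length-split : ∀ xs → length xs ≡ length (filter (λ x → P? x ⊎-dec ¬? (Q? x)) xs)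
                                  + length (filter (¬? ∘ P?) (filter Q? xs))
  length-split [] = refl
  length-split (x ∷ xs) with Q? x
  ... | no _ with P? x
  ...   | yes _ = cong suc (length-split xs)
  ...   | no _ = cong suc (length-split xs)
  length-split (x ∷ xs) | yes _ with P? x
  ...   | yes _ = cong suc (length-split xs)
  ...   | no _ = trans (cong suc (length-split xs)) (sym (+-suc _ _))

module _ {A : Set} {n : ℕ} (f : A → Fin n) {R : A → A → Set} {g : ℕ}
  (fibre≤ : ∀ {x is} → AllPairs R is → All (λ i → f i ≡ x) is → length is ≤ g) where

  length≤fibres : ∀ xs {is} → AllPairs R is → All (λ i → f i ∈ xs) is → length is ≤ length xs * g
  length≤fibres [] [] [] = z≤n
  length≤fibres (x ∷ xs) {is} rs mem = begin
    length is ≡⟨ length-complement f≟x is ⟩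
    length (filter f≟x is) + length (filter (¬? ∘ f≟x) is)
      ≤⟨ +-mono-≤ (fibre≤ (AllPairs.filter⁺ f≟x rs) (All.all-filter f≟x is))
                  (length≤fibres xs (AllPairs.filter⁺ (¬? ∘ f≟x) rs)
                    (All.zipWith (λ (m , ≢) → drop-head m ≢) (All.filter⁺ (¬? ∘ f≟x) mem , All.all-filter (¬? ∘ f≟x) is))) ⟩
    g + length xs * g ∎
    where
      open ≤-Reasoning
      f≟x : ∀ i → Dec (f i ≡ x)
      f≟x i = f i Fin.≟ x
      drop-head : ∀ {y} → y ∈ x ∷ xs → y ≢ x → y ∈ xs
      drop-head (here e) ≢ = contradiction e ≢
      drop-head (there m) _ = m

-- Closed neighbourhoods in the lexicographic product

module _ {V W : Set} (G : Graph V) (H : Graph W) where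

  fibre-nbh : ∀ {x y y′} → ClosedNbh H y y′ → ClosedNbh (Lex G H) (x , y) (x , y′)
  fibre-nbh (inj₁ refl) = inj₁ refl
  fibre-nbh (inj₂ adj) = inj₂ (inj₂ (refl , adj))

  fibre-nbh⁻ : (∀ {v} → ¬ Adj G v v) → ∀ {x y y′} → ClosedNbh (Lex G H) (x , y) (x , y′) → ClosedNbh H y y′
  fibre-nbh⁻ irrefl (inj₁ refl) = inj₁ refl
  fibre-nbh⁻ irrefl (inj₂ (inj₁ adj)) = contradiction adj irrefl
  fibre-nbh⁻ irrefl (inj₂ (inj₂ (_ , adj))) = inj₂ adj

  base-nbh : ∀ {x x′ y y′} → ClosedNbh (Lex G H) (x , y) (x′ , y′) → ClosedNbh G x x′
  base-nbh (inj₁ refl) = inj₁ refl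
  base-nbh (inj₂ (inj₁ adj)) = inj₂ adj
  base-nbh (inj₂ (inj₂ (e , _))) = inj₁ (sym e)

-- Upper bound: footprints and keys in the product

module LexFootprints {n k g : ℕ} (G : Graph (Fin n)) (H : Graph (Fin k))
  (irrefl : ∀ {v} → ¬ Adj G v v)
  (adjG? : ∀ u v → Dec (Adj G u v)) (adjH? : ∀ u v → Dec (Adj H u v))
  (legal≤ : ∀ ps → LegalPairs H ps → length ps ≤ g)
  (S : List (Fin n × Fin k)) (footprinted : Footprinted (Lex G H) S) where

  L : ℕ
  L = length S

  GH : Graph (Fin n × Fin k)
  GH = Lex G H

  c : Fin L → Fin n
  c i = proj₁ (lookup S i)

  h : Fin L → Fin k
  h i = proj₂ (lookup S i)

  nbh? : ∀ v u → Dec (ClosedNbh GH v u)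
  nbh? v@(x , y) u@(x′ , y′) = ≡-dec Fin._≟_ Fin._≟_ u v ⊎-dec (adjG? x x′ ⊎-dec ((x Fin.≟ x′) ×-dec adjH? y y′))

  Undominated : Fin L → Fin n × Fin k → Set
  Undominated i u = ∀ j → toℕ j < toℕ i → ¬ ClosedNbh GH (lookup S j) u

  undominated? : ∀ i u → Dec (Undominated i u)
  undominated? i u = Fin.all? (λ j → (toℕ j <? toℕ i) →-dec ¬? (nbh? (lookup S j) u))

  Vertical : Fin L → Set
  Vertical i = ∃ λ b → ClosedNbh H (h i) b × Undominated i (c i , b)

  vertical? : ∀ i → Dec (Vertical i)
  vertical? i = Fin.any? (λ b → closedNbh? H adjH? (h i) b ×-dec undominated? i (c i , b))

  -- The clause `¬ Vertical i` records the preference: another fibre is chosen only when the own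
  -- fibre offers no footprint.
  record Footprint (i : Fin L) : Set where
    field
      target : Fin n
      height : Fin k
      kind   : (target ≡ c i × ClosedNbh H (h i) height) ⊎ (Adj G (c i) target × ¬ Vertical i)
      fresh  : Undominated i (target , height)

  choose : ∀ i → Footprint i
  choose i with vertical? i
  ... | yes (b , nb , fr) = record { target = c i ; height = b ; kind = inj₁ (refl , nb) ; fresh = fr }
  ... | no ¬vert with footprinted i
  ...   | (a , b) , nb , fr = record { target = a ; height = b ; kind = kind nb ; fresh = fr }
    where
      kind : ClosedNbh GH (lookup S i) (a , b) → (a ≡ c i × ClosedNbh H (h i) b) ⊎ (Adj G (c i) a × ¬ Vertical i)
      kind (inj₁ e) = inj₁ (cong proj₁ e , inj₁ (cong proj₂ e))
      kind (inj₂ (inj₁ adj)) = inj₂ (adj , ¬vert)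
      kind (inj₂ (inj₂ (e , adj))) = inj₁ (sym e , inj₂ adj)

  a : Fin L → Fin n
  a i = Footprint.target (choose i)

  b : Fin L → Fin k
  b i = Footprint.height (choose i)

  fresh : ∀ i → Undominated i (a i , b i)
  fresh i = Footprint.fresh (choose i)

  -- A play over a neighbour of `a i` dominates the whole fibre over `a i`, whatever the heights.
  fresh-adj : ∀ {i j} → toℕ j < toℕ i → ¬ Adj G (c j) (a i)
  fresh-adj {i} {j} lt adj = fresh i j lt (inj₂ (inj₁ adj))

  covers : ∀ i → ClosedNbh G (c i) (a i)
  covers i with Footprint.kind (choose i)
  ... | inj₁ (e , _) = inj₁ e
  ... | inj₂ (adj , _) = inj₂ adj

  -- If j were not vertical, (c j , h j) would be dominated before j, either by a play over c j, so that a j is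
  -- dominated too early, or from a neighbouring fibre, so that the whole fibre over c j = a i is.
  retargeted⇒diagonal : ∀ {i j} → toℕ j < toℕ i → c j ≡ a i → a j ≡ c j
  retargeted⇒diagonal {i} {j} j<i cj≡ai with Footprint.kind (choose j)
  ... | inj₁ (e , _) = e
  ... | inj₂ (adj , ¬vert) = contradiction (h j , inj₁ refl , undom) ¬vert
    where
      same-centre : ∀ {l} → toℕ l < toℕ j → c l ≢ c j
      same-centre l<j e = fresh-adj l<j (subst (λ x → Adj G x (a j)) (sym e) adj)
      undom : Undominated j (c j , h j)
      undom l l<j (inj₁ e) = same-centre l<j (sym (cong proj₁ e))
      undom l l<j (inj₂ (inj₁ adj′)) = fresh-adj (<-trans l<j j<i) (subst (Adj G (c l)) cj≡ai adj′)
      undom l l<j (inj₂ (inj₂ (e , _))) = same-centre l<j e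

  Blocked : Fin L → Set
  Blocked i = ∃ λ j → toℕ j < toℕ i × c j ≡ a i

  key? : ∀ i → Dec (¬ Blocked i)
  key? i = ¬? (Fin.any? (λ j → (toℕ j <? toℕ i) ×-dec (c j Fin.≟ a i)))

  open Weight c a

  keys : List (Fin L)
  keys = filter key? (allFin L)

  keys-cover : All (λ i → ClosedNbh G (c i) (a i)) keys
  keys-cover = All.universal covers keys

  -- An earlier centre equal to `a j` is excluded because `j` is a key, an adjacent one by
  -- `fresh-adj`.
  keys-fresh : AllPairs (λ i j → ¬ ClosedNbh G (c i) (a j)) keys
  keys-fresh = allPairs-map-with
    (λ { _ ¬bl lt (inj₁ e) → ¬bl (_ , lt , sym e) ; _ _ lt (inj₂ adj) → fresh-adj lt adj })
    (All.all-filter key? (allFin L)) (AllPairs.filter⁺ key? (AllPairs.tabulate⁺-< id))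

  -- Descent on the index: a play that blocks `i` is diagonal with the same target, so the search
  -- continues from it until it meets a key. The hypothesis leaves out exactly the off-diagonal
  -- keys.
  first-key : ∀ {i} → Acc Fin._<_ i → a i ≡ c i ⊎ ¬ ¬ Blocked i → ∃ λ j → ¬ Blocked j × a j ≡ c j × a j ≡ a i
  first-key {i} (acc rec) p with Fin.any? (λ j → (toℕ j <? toℕ i) ×-dec (c j Fin.≟ a i)) | p
  ... | no ¬bl | inj₁ ai≡ci = i , ¬bl , ai≡ci , refl
  ... | no ¬bl | inj₂ ¬¬bl = contradiction ¬bl ¬¬bl
  ... | yes (j , j<i , cj≡ai) | _ =
    let aj≡cj = retargeted⇒diagonal j<i cj≡ai
        l , ¬bl , d , e = first-key (rec j<i) (inj₁ aj≡cj)
    in l , ¬bl , d , trans e (trans aj≡cj cj≡ai)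

  diagonal-targets : List (Fin n)
  diagonal-targets = map a (filter diag? keys)

  rest-target : ∀ {i} → a i ≡ c i ⊎ ¬ ¬ Blocked i → a i ∈ diagonal-targets
  rest-target p = let j , ¬bl , d , e = first-key (<-wellFounded _) p in
    subst (_∈ diagonal-targets) e (∈-map⁺ a (∈-filter⁺ diag? (∈-filter⁺ key? (∈-allFin j) ¬bl) d))

  fibre≤ : ∀ {x is} → AllPairs Fin._<_ is → All (λ i → a i ≡ x) is → length is ≤ g
  fibre≤ {x} {is} lt at = subst (_≤ g) (length-map pair is) (legal≤ (map pair is)
    ( All.map⁺ (All.universal own is)
    , AllPairs.map⁺ (allPairs-map-with (λ {i} {j} p q → later i j (trans p (sym q))) at lt)))
    where
      -- A horizontal play over a neighbour of x is replaced by its footprint in the fibre over x.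
      shadow : ∀ {i} → Footprint i → Fin k
      shadow {i} f with Footprint.kind f
      ... | inj₁ _ = h i
      ... | inj₂ _ = Footprint.height f
      pair : Fin L → Fin k × Fin k
      pair i = shadow (choose i) , b i
      own : ∀ i → ClosedNbh H (shadow (choose i)) (b i)
      own i with Footprint.kind (choose i)
      ... | inj₁ (_ , nb) = nb
      ... | inj₂ _ = inj₁ refl
      later : ∀ i j → a i ≡ a j → toℕ i < toℕ j → ¬ ClosedNbh H (shadow (choose i)) (b j)
      later i j ai≡aj i<j nb with Footprint.kind (choose i)
      ... | inj₁ (e , _) = fresh j i i<j
              (subst (λ x → ClosedNbh GH (lookup S i) (x , b j)) (trans (sym e) ai≡aj) (fibre-nbh G H nb))
      -- A horizontal play dominates its whole target fibre, so no later play can have the same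
      -- target.
      ... | inj₂ (adj , _) = fresh-adj i<j (subst (Adj G (c i)) ai≡aj adj)

  -- Every play other than an off-diagonal key shares its target with a diagonal key, and at most
  -- `g` plays share one target.
  length≤weight : length S ≤ weight g keys
  length≤weight = begin
    L                 ≡⟨ sym (length-tabulate {n = L} id) ⟩
    length (allFin L) ≡⟨ length-split diag? key? (allFin L) ⟩
    length rest + length (filter (¬? ∘ diag?) keys)
      ≤⟨ +-monoˡ-≤ _ (length≤fibres a fibre≤ diagonal-targets
           (AllPairs.filter⁺ rest? (AllPairs.tabulate⁺-< id))
           (All.map rest-target (All.all-filter rest? (allFin L)))) ⟩
    length diagonal-targets * g + length (filter (¬? ∘ diag?) keys)
      ≡⟨ cong (λ l → l * g + length (filter (¬? ∘ diag?) keys)) (length-map a (filter diag? keys)) ⟩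
    weight g keys     ∎
    where
      open ≤-Reasoning
      rest? : ∀ i → Dec (a i ≡ c i ⊎ ¬ ¬ Blocked i)
      rest? i = diag? i ⊎-dec ¬? (key? i)
      rest : List (Fin L)
      rest = filter rest? (allFin L)

-- Lower bound: full copies and single plays

module Construction (m n : ℕ) {k : ℕ} (1≤m : 1 ≤ m) (2m<n : m + m < n) (H : Graph (Fin k))
  (ps : List (Fin k × Fin k)) (legal : LegalPairs H ps) (dominating : Dominates H (map proj₁ ps))
  (h₀ : Fin k) where

  open Cycle m n 2m<n

  GH : Graph (Fin n × Fin k)
  GH = Lex G H

  -- The fibres that may be dominated once the front has moved from 0 to e.  Since the first play is over 0,
  -- the last m fibres always count among them.
  Done : ℕ → Fin n → Set
  Done e v = toℕ v < e ⊎ n ≤ toℕ v + m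

  -- The sequence is built from its end. Such a suffix may follow any legal plays that dominate only
  -- vertices in fibres that are `Done e`, and it takes care of all fibres from `e` on.
  record Completes (e : ℕ) (qs : List ((Fin n × Fin k) × (Fin n × Fin k))) : Set where
    field
      legal-pairs : LegalPairs GH qs
      open-targets : All (λ q → ¬ Done e (proj₁ (proj₂ q))) qs
      dominates : ∀ u → e ≤ toℕ (proj₁ u) → ∃ λ q → q ∈ qs × ClosedNbh GH (proj₁ q) u

  open Completes

  done-mono : ∀ {e e′ v} → e ≤ e′ → Done e v → Done e′ v
  done-mono e≤e′ (inj₁ lt) = inj₁ (<-≤-trans lt e≤e′)
  done-mono e≤e′ (inj₂ le) = inj₂ le

  undone : ∀ {e v} → toℕ v ≡ e → e + m < n → ¬ Done e v
  undone refl _ (inj₁ lt) = <-irrefl refl lt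
  undone refl lt (inj₂ le) = <⇒≱ lt le

  -- No neighbour wraps upwards since `toℕ v + m < n`; one reached by wrapping below `0` is among
  -- the last `m` fibres.
  nbh⇒done : ∀ {v w} → toℕ v + m < n → ClosedNbh G v w → Done (suc (toℕ v + m)) w
  nbh⇒done {v} {w} lt nb with nbh⇒near nb
  ... | inj₁ (_ , q) = inj₁ (s≤s q)
  ... | inj₂ (inj₁ p) = inj₂ (≤-trans (m≤n+m n (toℕ v)) p)
  ... | inj₂ (inj₂ p) = contradiction (≤-trans (m≤n+m n (toℕ w)) p) (<⇒≱ lt)

  new-targets : ∀ {e qs v y} → toℕ v + m < n → suc (toℕ v + m) ≤ e → Completes e qs →
                All (λ q → ¬ ClosedNbh GH (v , y) (proj₂ q)) qs
  new-targets lt le comp = All.map (λ ¬d nb → ¬d (done-mono le (nbh⇒done lt (base-nbh G H nb)))) (open-targets comp)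

  empty-completes : ∀ {e} → n ≤ e → Completes e []
  empty-completes n≤e = record
    { legal-pairs = [] , [] ; open-targets = []
    ; dominates = λ u e≤u → contradiction (≤-trans n≤e e≤u) (<⇒≱ (Fin.toℕ<n (proj₁ u))) }

  -- A play over `x` footprints the farthest fibre it reaches, `x + m`, and dominates it entirely:
  -- the front advances by one.
  single-completes : ∀ {x e qs} → e ≡ x + m → e + m < n → Completes (suc e) qs →
                     ∃ λ q → Completes e (q ∷ qs)
  single-completes {x} {e} {qs} refl lt comp = ((v , h₀) , (w , h₀)) , record
    { legal-pairs = (inj₂ (inj₁ adj) ∷ proj₁ (legal-pairs comp))
                  , (new-targets v+m<n (s≤s (≤-reflexive (cong (_+ m) toℕ-v))) comp ∷ proj₂ (legal-pairs comp))
    ; open-targets = undone toℕ-w lt ∷ All.map (_∘ done-mono (n≤1+n e)) (open-targets comp)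
    ; dominates = dom }
    where
      e<n : e < n
      e<n = ≤-<-trans (m≤m+n e m) lt
      x<n : x < n
      x<n = ≤-<-trans (m≤m+n x m) e<n
      v = fromℕ< x<n
      w = fromℕ< e<n
      toℕ-v : toℕ v ≡ x
      toℕ-v = Fin.toℕ-fromℕ< x<n
      toℕ-w : toℕ w ≡ e
      toℕ-w = Fin.toℕ-fromℕ< e<n
      v+m<n : toℕ v + m < n
      v+m<n = subst (λ t → t + m < n) (sym toℕ-v) e<n
      adj : Adj G v w
      -- Here `1≤m` is what makes `x` and `x + m` distinct.
      adj = near⇒adj (λ v≡w → <⇒≢ (m<m+n x 1≤m) (trans (sym toℕ-v) (trans (cong toℕ v≡w) toℕ-w)))
        (subst₂ Near (sym toℕ-v) (sym toℕ-w) (inj₁ (≤-trans (m≤m+n x m) (m≤m+n e m) , ≤-refl)))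
      dom : ∀ u → e ≤ toℕ (proj₁ u) → ∃ λ q → q ∈ ((v , h₀) , (w , h₀)) ∷ qs × ClosedNbh GH (proj₁ q) u
      dom u e≤u with m≤n⇒m<n∨m≡n e≤u
      ... | inj₁ e<u = let q , q∈ , nb = dominates comp u e<u in q , there q∈ , nb
      ... | inj₂ e≡u = _ , here refl , inj₂ (inj₁ (subst (Adj G v) (Fin.toℕ-injective (trans toℕ-w e≡u)) adj))

  -- A copy of the Grundy sequence over `e` dominates the fibres `e`, ..., `e + m`, so the front
  -- advances by `suc m`.
  block-completes : ∀ {e qs} → e + m < n → Completes (suc (e + m)) qs →
                    ∃ λ bs → Completes e (bs ++ qs) × length bs ≡ length ps
  block-completes {e} {qs} lt comp = bs , record
    { legal-pairs = All.++⁺ (All.map⁺ (All.map (fibre-nbh G H) (proj₁ legal))) (proj₁ (legal-pairs comp))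
                  , AllPairs.++⁺
                      (AllPairs.map⁺ (AllPairs.map (_∘ fibre-nbh⁻ G H (λ {v} → adj-irrefl {v})) (proj₂ legal)))
                      (proj₂ (legal-pairs comp))
                      (All.map⁺ (All.universal (λ _ → new-targets v+m<n (s≤s (≤-reflexive (cong (_+ m) toℕ-v))) comp) ps))
    ; open-targets = All.++⁺ (All.map⁺ (All.universal (λ _ → undone toℕ-v lt) ps))
                             (All.map (_∘ done-mono (m≤n⇒m≤1+n (m≤m+n e m))) (open-targets comp))
    ; dominates = dom }
    , length-map lift ps
    where
      e<n : e < n
      e<n = ≤-<-trans (m≤m+n e m) lt
      v = fromℕ< e<n
      toℕ-v : toℕ v ≡ e
      toℕ-v = Fin.toℕ-fromℕ< e<n
      v+m<n : toℕ v + m < n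
      v+m<n = subst (λ t → t + m < n) (sym toℕ-v) lt
      lift : Fin k × Fin k → (Fin n × Fin k) × (Fin n × Fin k)
      lift (y , u) = (v , y) , (v , u)
      bs = map lift ps
      Covered : Fin n × Fin k → Set
      Covered u = ∃ λ q → q ∈ bs ++ qs × ClosedNbh GH (proj₁ q) u
      from-block : ∀ {u} h → (∀ {y} → ClosedNbh H y h → ClosedNbh GH (v , y) u) → Covered u
      from-block h f with dominating h
      ... | y , y∈ , nb with ∈-map⁻ proj₁ y∈
      ...   | p , p∈ , refl = lift p , ∈-++⁺ˡ (∈-map⁺ lift p∈) , f nb
      dom : ∀ u → e ≤ toℕ (proj₁ u) → Covered u
      dom u@(x , h) e≤u with toℕ x ≤? e + m
      ... | no u≰ = let q , q∈ , nb = dominates comp u (≰⇒> u≰) in q , ∈-++⁺ʳ bs q∈ , nb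
      ... | yes u≤ with near⇒nbh {v} {x} (subst (λ t → Near t (toℕ x)) (sym toℕ-v) (inj₁ (≤-trans e≤u (m≤m+n _ m) , u≤)))
      ...   | inj₁ refl = from-block h (fibre-nbh G H)
      -- Any play of the block would do; domination of `h` just supplies one.
      ...   | inj₂ adj = from-block h (λ _ → inj₂ (inj₁ adj))

  blocks : ∀ t {e} → e + t * suc m ≡ n → ∃ λ qs → Completes e qs × length qs ≡ t * length ps
  blocks zero {e} eq = [] , empty-completes (≤-reflexive (trans (sym eq) (+-identityʳ e))) , refl
  blocks (suc t) {e} eq = let
      eq′ = trans (trans (cong (_+ t * suc m) (sym (+-suc e m))) (+-assoc e (suc m) _)) eq
      qs , comp , len = blocks t eq′
      bs , comp′ , len′ = block-completes (subst (suc (e + m) ≤_) eq′ (m≤m+n _ _)) comp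
    in bs ++ qs , comp′ , trans (length-++ bs) (cong₂ _+_ len′ len)

  -- At least one block follows, which keeps `e + m < n`: no single play has its footprint in the
  -- last `m` fibres.
  singles : ∀ r t x {e} → e ≡ x + m → e + (r + suc t * suc m) ≡ n →
            ∃ λ qs → Completes e qs × length qs ≡ r + suc t * length ps
  singles zero t x _ eq = blocks (suc t) eq
  singles (suc r) t x {e} e≡ eq = let
      eq′ = trans (sym (+-suc e _)) eq
      qs , comp , len = singles r t (suc x) (cong suc e≡) eq′
      q , comp′ = single-completes {x} e≡ (subst (suc (e + m) ≤_) eq′
        (s≤s (+-monoʳ-≤ e (≤-trans (n≤1+n m) (≤-trans (m≤m+n (suc m) (t * suc m)) (m≤n+m _ r)))))) comp
    in q ∷ qs , comp′ , cong suc len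

  achieved : ∀ t → (2 + t) * suc m ≤ n →
             ∃ λ S → LegalDominating GH S × length S ≡ (2 + t) * length ps + (n ∸ (2 + t) * suc m)
  achieved t fits = let
      r = n ∸ (2 + t) * suc m
      -- The block over `0` moves the front to `suc m`, that is `1 + m`, so the single plays start
      -- over `1`.
      qs , comp , len = singles r t 1 refl (begin
        suc m + (r + suc t * suc m) ≡⟨ cong (suc m +_) (+-comm r _) ⟩
        suc m + (suc t * suc m + r) ≡⟨ sym (+-assoc (suc m) _ r) ⟩
        (2 + t) * suc m + r         ≡⟨ m+[n∸m]≡n fits ⟩
        n                           ∎)
      bs , comp′ , len′ = block-completes {0} m<n comp
    in map proj₁ (bs ++ qs)
     , legal⇒legalDominating GH (legal-pairs comp′) (λ u →
         let q , q∈ , nb = dominates comp′ u z≤n in proj₁ q , ∈-map⁺ proj₁ q∈ , nb)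
     , (begin
        length (map proj₁ (bs ++ qs))         ≡⟨ length-map proj₁ (bs ++ qs) ⟩
        length (bs ++ qs)                     ≡⟨ length-++ bs ⟩
        length bs + length qs                 ≡⟨ cong₂ _+_ len′ len ⟩
        length ps + (r + suc t * length ps)   ≡⟨ cong (length ps +_) (+-comm r _) ⟩
        length ps + (suc t * length ps + r)   ≡⟨ sym (+-assoc (length ps) _ r) ⟩
        (2 + t) * length ps + r               ∎)
    where open ≡-Reasoning

-- Undecidable adjacency and the arithmetic of the two bounds

¬¬-∀ : ∀ {n} {P : Fin n → Set} → (∀ i → ¬ ¬ P i) → ¬ ¬ (∀ i → P i)
¬¬-∀ {zero} f k = k λ ()
¬¬-∀ {suc n} f k = f Fin.zero λ p → ¬¬-∀ (f ∘ Fin.suc) λ ps → k (Fin.∀-cons p ps)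

-- Adjacency in H need not be decidable, but the upper bound is a stable proposition.
¬¬-adj? : ∀ {k} (H : Graph (Fin k)) → ¬ ¬ (∀ u v → Dec (Adj H u v))
¬¬-adj? H = ¬¬-∀ λ u → ¬¬-∀ λ v → ¬¬-excluded-middle

*-∸-+ : ∀ p {g s} → s ≤ g → p * g ≡ p * (g ∸ s) + p * s
*-∸-+ p {g} {s} s≤g = trans (cong (p *_) (sym (m∸n+n≡m s≤g))) (*-distribˡ-+ p (g ∸ s) s)

-- With `g` split as `(g ∸ suc m) + suc m`, the packing bound pays for the second part and `q`, and
-- it limits `p` to the quotient.
weight-large : ∀ {m g n} p q → suc m ≤ g → p * suc m + q ≤ n → p * g + q ≤ (n / suc m) * (g ∸ suc m) + n
weight-large {m} {g} {n} p q s≤g packed = begin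
  p * g + q                           ≡⟨ cong (_+ q) (*-∸-+ p s≤g) ⟩
  p * (g ∸ suc m) + p * suc m + q     ≡⟨ +-assoc (p * (g ∸ suc m)) _ q ⟩
  p * (g ∸ suc m) + (p * suc m + q)   ≤⟨ +-mono-≤ (*-monoˡ-≤ (g ∸ suc m) p≤) packed ⟩
  (n / suc m) * (g ∸ suc m) + n       ∎
  where
    open ≤-Reasoning
    p≤ : p ≤ n / suc m
    p≤ = subst (_≤ n / suc m) (m*n/n≡m p (suc m)) (/-monoˡ-≤ (suc m) (≤-trans (m≤m+n _ q) packed))

spread⇒≤ : ∀ m {n r} → r + (m + m) ≤ n → r ≤ 2 + (n ∸ 2 * suc m)
spread⇒≤ m {n} {r} le = +-cancelʳ-≤ (m + m) r _ (begin
  r + (m + m)                       ≤⟨ le ⟩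
  n                                 ≤⟨ m≤n+m∸n n (2 * suc m) ⟩
  2 * suc m + (n ∸ 2 * suc m)       ≡⟨ cong (_+ (n ∸ 2 * suc m)) (trans (*-suc 2 m) (cong (λ t → 2 + (m + t)) (+-identityʳ m))) ⟩
  2 + (m + m) + (n ∸ 2 * suc m)     ≡⟨ cong (2 +_) (+-comm (m + m) _) ⟩
  2 + (n ∸ 2 * suc m) + (m + m)     ∎)
  where open ≤-Reasoning

-- For `p ≥ 2`, two terms `g` are kept and the others raised to `suc m`, so that packing applies.
-- For `p ≤ 1` packing is too weak, and the spread bound with `1 ≤ g` takes over.
weight-small : ∀ {m g n} p q → 1 ≤ g → g ≤ m → p * suc m + q ≤ n → p + q + (m + m) ≤ n →
               p * g + q ≤ 2 * g + (n ∸ 2 * suc m)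
weight-small {m} {g} {n} (suc (suc p)) q 1≤g g≤m packed _ = begin
  (2 + p) * g + q          ≡⟨ cong (_+ q) (*-distribʳ-+ g 2 p) ⟩
  2 * g + p * g + q        ≡⟨ +-assoc (2 * g) (p * g) q ⟩
  2 * g + (p * g + q)      ≤⟨ +-monoʳ-≤ (2 * g) (+-monoˡ-≤ q (*-monoʳ-≤ p (m≤n⇒m≤1+n g≤m))) ⟩
  2 * g + (p * suc m + q)  ≤⟨ +-monoʳ-≤ (2 * g) (m+n≤o⇒m≤o∸n _ (begin
    p * suc m + q + 2 * suc m   ≡⟨ +-comm _ (2 * suc m) ⟩
    2 * suc m + (p * suc m + q) ≡⟨ sym (+-assoc (2 * suc m) _ q) ⟩
    2 * suc m + p * suc m + q   ≡⟨ cong (_+ q) (sym (*-distribʳ-+ (suc m) 2 p)) ⟩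
    (2 + p) * suc m + q         ≤⟨ packed ⟩
    n                           ∎)) ⟩
  2 * g + (n ∸ 2 * suc m)  ∎
  where open ≤-Reasoning
weight-small {m} {g} {n} (suc zero) q 1≤g g≤m _ spread = begin
  1 * g + q                     ≤⟨ +-mono-≤ (≤-refl {1 * g}) (≤-pred (spread⇒≤ m spread)) ⟩
  1 * g + (1 + (n ∸ 2 * suc m)) ≤⟨ +-monoʳ-≤ (1 * g) (+-monoˡ-≤ _ 1≤g) ⟩
  1 * g + (g + (n ∸ 2 * suc m)) ≡⟨ sym (+-assoc (1 * g) g _) ⟩
  1 * g + g + (n ∸ 2 * suc m)   ≡⟨ cong (_+ (n ∸ 2 * suc m)) (+-comm (1 * g) g) ⟩
  2 * g + (n ∸ 2 * suc m)       ∎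
  where open ≤-Reasoning
weight-small {m} {g} {n} zero q 1≤g g≤m _ spread =
  ≤-trans (spread⇒≤ m spread) (+-monoˡ-≤ _ (*-monoʳ-≤ 2 1≤g))

-- Assembling the upper bound

module _ (m n k g : ℕ) (H : Graph (Fin k)) (2m<n : m + m < n)
  (bound : ∀ S → LegalDominating H S → length S ≤ g) where

  legal-weight : (∀ u v → Dec (Adj H u v)) → ∀ S → Footprinted (Lex (CyclePow n m) H) S →
    ∃ λ p → ∃ λ q → length S ≤ p * g + q × p * suc m + q ≤ n × p + q + (m + m) ≤ n
  legal-weight adjH? S fp = length (filter diag? keys) , length (filter (¬? ∘ diag?) keys)
    , length≤weight , packing-bound c a keys-cover keys-fresh
    , subst (λ l → l + (m + m) ≤ n) (length-complement diag? keys) (spread keys-cover keys-fresh)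
    where
      open Cycle m n 2m<n
      open LexFootprints G H (λ {v} → adj-irrefl {v}) adj? adjH? (legal-length≤ H adjH? bound) S fp
      open Weight c a
      spread : ∀ {is} → All (Covers c a) is → AllPairs (Fresh c a) is → length is + (m + m) ≤ n
      spread {[]} _ _ = <⇒≤ 2m<n
      spread {i ∷ is} cov fr = length-bound c a cov fr

  upper-bound : ∀ {d} → (∀ p q → p * suc m + q ≤ n → p + q + (m + m) ≤ n → p * g + q ≤ d) →
                ∀ S → Footprinted (Lex (CyclePow n m) H) S → length S ≤ d
  upper-bound {d} arith S fp = decidable-stable (length S ≤? d) λ ≰ → ¬¬-adj? H λ adjH? →
    let p , q , le , packed , spread = legal-weight adjH? S fp in ≰ (≤-trans le (arith p q packed spread))

-- The two values of the Grundy domination number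

theorem3 : (m n k : ℕ) (H : Graph (Fin k)) → IsSimple H → 1 ≤ k →
    1 ≤ m → 2 * suc m ≤ n →
    (g : ℕ) → IsGrundyDom H g →
    (suc m ≤ g → IsGrundyDom (Lex (CyclePow n m) H) ((n / suc m) * (g ∸ suc m) + n))
    × (g ≤ m → IsGrundyDom (Lex (CyclePow n m) H) (2 * g + (n ∸ 2 * suc m)))
theorem3 m n k H _ 1≤k 1≤m 2s≤n g ((S , (_ , dominating , footprinted) , refl) , bound)
  with footprinted⇒legal H {S} footprinted
... | ps , legal , refl = large , small
  where
    h₀ : Fin k
    h₀ = fromℕ< 1≤k

    2m<n : m + m < n
    2m<n = <-≤-trans (m+m<2s m) 2s≤n
      where
        m+m<2s : ∀ m → m + m < 2 * suc m
        m+m<2s m rewrite +-identityʳ m = +-mono-≤ (n<1+n m) (n≤1+n m)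

    1≤g : 1 ≤ g
    1≤g = nonempty (dominating h₀)
      where
        nonempty : ∀ {A : Set} {P : A → Set} {xs} → (∃ λ v → v ∈ xs × P v) → 1 ≤ length xs
        nonempty (_ , here _ , _) = s≤s z≤n
        nonempty (_ , there _ , _) = s≤s z≤n

    achieved : ∀ p → 2 ≤ p → p * suc m ≤ n →
      ∃ λ S → LegalDominating (Lex (CyclePow n m) H) S × length S ≡ p * g + (n ∸ p * suc m)
    achieved (suc zero) (s≤s ()) _
    achieved (suc (suc t)) _ fits = let S′ , ld , len = Construction.achieved m n 1≤m 2m<n H ps legal dominating h₀ t fits
      in S′ , ld , trans len (cong (λ l → (2 + t) * l + (n ∸ (2 + t) * suc m)) (sym (length-map proj₁ ps)))

    large : suc m ≤ g → IsGrundyDom (Lex (CyclePow n m) H) ((n / suc m) * (g ∸ suc m) + n)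
    -- A block gives `g ≥ suc m` plays on `suc m` fibres, so as many blocks as fit are used.
    large s≤g = (let S′ , ld , len = achieved q 2≤q (m/n*n≤m n (suc m)) in S′ , ld , trans len rearrange)
      , λ S′ (_ , _ , fp) → upper-bound m n k g H 2m<n bound (λ p r packed _ → weight-large p r s≤g packed) S′ fp
      where
        q : ℕ
        q = n / suc m
        2≤q : 2 ≤ q
        2≤q = subst (_≤ q) (m*n/n≡m 2 (suc m)) (/-monoˡ-≤ (suc m) 2s≤n)
        rearrange : q * g + (n ∸ q * suc m) ≡ q * (g ∸ suc m) + n
        rearrange = begin
          q * g + (n ∸ q * suc m)                           ≡⟨ cong (_+ (n ∸ q * suc m)) (*-∸-+ q s≤g) ⟩
          q * (g ∸ suc m) + q * suc m + (n ∸ q * suc m)     ≡⟨ +-assoc (q * (g ∸ suc m)) _ _ ⟩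
          q * (g ∸ suc m) + (q * suc m + (n ∸ q * suc m))   ≡⟨ cong (q * (g ∸ suc m) +_) (m+[n∸m]≡n (m/n*n≤m n (suc m))) ⟩
          q * (g ∸ suc m) + n                               ∎
          where open ≡-Reasoning

    small : g ≤ m → IsGrundyDom (Lex (CyclePow n m) H) (2 * g + (n ∸ 2 * suc m))
    -- A block now gives fewer plays than `suc m` singles, so only the two blocks that the
    -- construction requires are used.
    small g≤m = achieved 2 ≤-refl 2s≤n
      , λ S′ (_ , _ , fp) → upper-bound m n k g H 2m<n bound (λ p q → weight-small p q 1≤g g≤m) S′ fp
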